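{- Algorithm \textsf{A} (defined below), run on an undirected graph with vertex set $[n]$, $n>1$, takes $O(\lg^2 n)$ steps.
   Context: Each edge $e$ has two ends $e.v,e.w$; the current edge set is initially the input edge set. Each vertex $v$ has a parent $v.p$, initially $v$. Vertices are compared as integers. Each operation is performed simultaneously for all edges/vertices using values at the start of the operation. \textsc{connect}: for each current edge $e$, send $\min\{e.v,e.w\}$ to $\max\{e.v,e.w\}$. \textsc{update}: for each vertex $v$, replace $v.p$ by the minimum of $v.p$ and the vertices sent to $v$ in the preceding \textsc{connect}. \textsc{shortcut}: for each vertex $v$, replace $v.p$ by $(v.p).p$. \textsc{alter}: for each edge $e$, let $x=e.v.p$, $y=e.w.p$; if $x=y$ delete $e$, else replace $e.v,e.w$ by $x,y$. Algorithm \textsf{A}: repeat \{\textsc{connect}; \textsc{update}; \textsc{shortcut}; \textsc{alter}\} until no parent changes. Each iteration is a round; a round consists of a constant number of synchronous concurrent message-passing steps, so the number of steps is within a constant factor of the number of rounds. $\lg$ is the base-two logarithm. -}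

module Defs where

open import Data.Nat using (ℕ; zero; suc; _≤ᵇ_)
open import Data.Fin using (Fin; toℕ; _≟_)
open import Data.List using (List; []; _∷_; foldr; filter; map; allFin)
open import Data.List.Relation.Unary.All using (All)
open import Data.Product using (_×_; _,_; proj₁; proj₂)
open import Data.Bool using (Bool; true; false; if_then_else_; _∧_)
open import Relation.Nullary.Decidable using (⌊_⌋; ¬?)
open import Relation.Binary.PropositionalEquality using (_≡_)

minF : ∀ {n} → Fin n → Fin n → Fin n
minF a b = if toℕ a ≤ᵇ toℕ b then a else b

maxF : ∀ {n} → Fin n → Fin n → Fin n
maxF a b = if toℕ a ≤ᵇ toℕ b then b else a

-- An edge is an (unordered) pair of ends e.v, e.w; the edge set is a list.
Edge : ℕ → Set
Edge n = Fin n × Fin n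

record State (n : ℕ) : Set where
  constructor st
  field
    par   : Fin n → Fin n
    edges : List (Edge n)
open State public

initState : ∀ {n} → List (Edge n) → State n
initState es = st (λ v → v) es

connectUpdate : ∀ {n} → State n → (Fin n → Fin n)
connectUpdate s v =
  foldr (λ e acc → if ⌊ maxF (proj₁ e) (proj₂ e) ≟ v ⌋
                    then minF (minF (proj₁ e) (proj₂ e)) acc else acc)
        (par s v) (edges s)

shortcut : ∀ {n} → (Fin n → Fin n) → (Fin n → Fin n)
shortcut p v = p (p v)

alter : ∀ {n} → (Fin n → Fin n) → List (Edge n) → List (Edge n)
alter p es =
  filter (λ e → ¬? (proj₁ e ≟ proj₂ e))
         (map (λ e → (p (proj₁ e) , p (proj₂ e))) es)

round : ∀ {n} → State n → State n
round s = st p₂ (alter p₂ (edges s))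
  where
    p₁ = connectUpdate s
    p₂ = shortcut p₁

sameFun : ∀ {n} → (Fin n → Fin n) → (Fin n → Fin n) → Bool
sameFun {n} f g = foldr (λ v b → ⌊ f v ≟ g v ⌋ ∧ b) true (allFin n)

noChange : ∀ {n} → State n → Bool
noChange s = sameFun (par s) p₁ ∧ sameFun p₁ (shortcut p₁)
  where p₁ = connectUpdate s

-- haltsWithin k s = true iff algorithm A, started in state s, stops after
-- at most k rounds (the final round, in which no parent changes, is counted).
haltsWithin : ∀ {n} → ℕ → State n → Bool
haltsWithin zero s = false
haltsWithin (suc k) s = if noChange s then true else haltsWithin k (round s)

{-# OPTIONS --safe #-}
module Submission where

-- The ends of edges move like tokens: initially one token per vertex, and in each
-- round the token at v moves to q (q v), where q is the parent map after CONNECT.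
-- Parents of occupied vertices stay occupied, so everything is decided on the shrinking
-- set of occupied vertices, where q is a forest with decreasing parents.
-- Let Φ be the sum of log (v − q v) over the occupied nonroots.  After the shortcut the
-- gap of v is the sum of the gaps of v and q v; by concavity of log the new summand is
-- at least half the sum of the two old ones plus 1/2.  Summed over the
-- forest this gives 2 Φ′ ≥ 2 Φ + #nonroots − O(log n) · #(nonroots losing their tokens),
-- because the leaves, whose number bounds all the deviations of q from a bijection, lose
-- their tokens.  A root that still takes part either has a child or becomes a nonroot in
-- the next round.  Hence O(log n) · #active − 2 Φ decreases by a factor 1 − Ω(1/log n)
-- every two rounds and vanishes after O(log² n) rounds, when no edge is left; the
-- shortcuts then flatten the trees in O(log n) rounds.

open import Defs
open import Data.Nat using (ℕ; zero; suc; _+_; _∸_; _*_; _^_; _≤_; _<_; z≤n; s≤s; NonZero; >-nonZero)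
open import Data.Nat.Properties hiding (_≟_)
open import Data.Nat.Logarithm using (⌊log₂_⌋; ⌊log₂⌋-mono-≤; ⌊log₂[2*b]⌋≡1+⌊log₂b⌋; ⌊log₂[2^n]⌋≡n)
open import Data.Nat.GeneralisedArithmetic using (fold; iterate; iterate-is-fold)
open import Data.Nat.Tactic.RingSolver using (solve-∀)
open import Data.Bool using (true; false; if_then_else_; _∧_)
open import Data.Fin as F using (Fin; zero; suc; toℕ; _≟_)
open import Data.Fin.Properties using (any?; toℕ-injective; toℕ<n)
open import Data.List using (List; []; _∷_; foldr; allFin)
open import Data.List.Membership.Propositional using (_∈_)
open import Data.List.Membership.Propositional.Properties using (∈-map⁺; ∈-map⁻; ∈-filter⁺; ∈-filter⁻)
open import Data.List.Relation.Unary.Any using (here; there)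
import Data.List.Membership.DecPropositional as DecMembership
open import Data.Product using (Σ; ∃; ∃₂; _×_; _,_; proj₁; proj₂)
open import Data.Product.Properties using (≡-dec)
open import Data.Sum using (_⊎_; inj₁; inj₂)
open import Function using (_∘_)
open import Relation.Nullary using (¬_; Dec; yes; no; does; contradiction; ofʸ; ofⁿ)
open import Relation.Nullary.Decidable using (_×-dec_; _⊎-dec_; ¬?; ⌊_⌋)
open import Relation.Unary using (Pred; Decidable)
open import Level using (0ℓ)
open import Relation.Binary.PropositionalEquality using (_≡_; _≢_; refl; sym; trans; cong; cong₂; subst)
open import Algebra.Properties.CommutativeMonoid.Sum +-0-commutativeMonoid
  using (sum; ∑-distrib-+; ∑-comm; sum-cong-≗)

-- Sums over decidable subsets of Fin n

sum-mono-≤ : ∀ {n} {f g : Fin n → ℕ} → (∀ v → f v ≤ g v) → sum f ≤ sum g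
sum-mono-≤ {zero}  f≤g = z≤n
sum-mono-≤ {suc n} f≤g = +-mono-≤ (f≤g zero) (sum-mono-≤ (f≤g ∘ suc))

term≤sum : ∀ {n} (f : Fin n → ℕ) v → f v ≤ sum f
term≤sum f zero    = m≤m+n _ _
term≤sum f (suc v) = ≤-trans (term≤sum (f ∘ suc) v) (m≤n+m _ _)

sum-const-≤ : ∀ {n} {f : Fin n → ℕ} {c} → (∀ v → f v ≤ c) → sum f ≤ n * c
sum-const-≤ {zero}  f≤c = z≤n
sum-const-≤ {suc n} f≤c = +-mono-≤ (f≤c zero) (sum-const-≤ (f≤c ∘ suc))

sum-support-≤ : ∀ {n} (f : Fin n → ℕ) v → (∀ u → v ≢ u → f u ≡ 0) → sum f ≤ f v
sum-support-≤ {suc n} f zero    off = subst (sum f ≤_) (+-identityʳ _)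
  (+-monoʳ-≤ (f zero) (≤-trans (sum-const-≤ (λ u → ≤-reflexive (off (suc u) λ ()))) (≤-reflexive (*-zeroʳ n))))
sum-support-≤ f (suc v) off = subst (λ z → z + sum (f ∘ suc) ≤ f (suc v)) (sym (off zero λ ()))
  (sum-support-≤ (f ∘ suc) v (λ u v≢u → off (suc u) (λ { refl → v≢u refl })))

when : ∀ {A : Set} → Dec A → ℕ → ℕ
when a? m = if does a? then m else 0

when-yes : ∀ {A : Set} (a? : Dec A) {m} → A → when a? m ≡ m
when-yes (yes _) a = refl
when-yes (no ¬a) a = contradiction a ¬a

when-no : ∀ {A : Set} (a? : Dec A) {m} → ¬ A → when a? m ≡ 0
when-no (yes a) ¬a = contradiction a ¬a
when-no (no _)  ¬a = refl

when-≤ : ∀ {A : Set} (a? : Dec A) {m k} → (A → m ≤ k) → when a? m ≤ k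
when-≤ (yes a) m≤k = m≤k a
when-≤ (no _)  m≤k = z≤n

≤-when : ∀ {A : Set} (a? : Dec A) {m k} → A → k ≤ m → k ≤ when a? m
≤-when a? a k≤m = ≤-trans k≤m (≤-reflexive (sym (when-yes a? a)))

module _ {n : ℕ} where

  ∑⟨_⟩ : {P : Pred (Fin n) 0ℓ} → Decidable P → (Fin n → ℕ) → ℕ
  ∑⟨ P? ⟩ f = sum (λ v → when (P? v) (f v))

  count : {P : Pred (Fin n) 0ℓ} → Decidable P → ℕ
  count P? = ∑⟨ P? ⟩ (λ _ → 1)

  module _ {P Q : Pred (Fin n) 0ℓ} (P? : Decidable P) (Q? : Decidable Q) where

    ∑-mono : ∀ {f g} → (∀ {v} → P v → Q v) → (∀ v → P v → f v ≤ g v) → ∑⟨ P? ⟩ f ≤ ∑⟨ Q? ⟩ g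
    ∑-mono P⊆Q f≤g = sum-mono-≤ λ v → when-≤ (P? v) λ p → ≤-when (Q? v) (P⊆Q p) (f≤g v p)

    -- The right-hand sum counts f v once for every preimage of v under h.
    ∑-surjection : ∀ {f} (h : Fin n → Fin n) →
      (∀ v → Q v → ∃ λ u → P u × h u ≡ v) → ∑⟨ Q? ⟩ f ≤ ∑⟨ P? ⟩ (f ∘ h)
    ∑-surjection {f} h onto = begin
      ∑⟨ Q? ⟩ f                        ≤⟨ sum-mono-≤ (λ v → when-≤ (Q? v) (preimage v)) ⟩
      sum (λ v → sum (λ u → pair u v)) ≡⟨ ∑-comm (λ v u → pair u v) ⟩
      sum (λ u → sum (pair u))         ≤⟨ sum-mono-≤ image ⟩
      ∑⟨ P? ⟩ (f ∘ h)                  ∎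
      where
      open ≤-Reasoning
      pair : Fin n → Fin n → ℕ
      pair u v = when (h u ≟ v) (when (P? u) (f v))
      preimage : ∀ v → Q v → f v ≤ sum (λ u → pair u v)
      preimage v q with onto v q
      ... | u , p , hu≡v = ≤-trans
        (≤-when (h u ≟ v) hu≡v (≤-when (P? u) p ≤-refl)) (term≤sum (λ u → pair u v) u)
      image : ∀ u → sum (pair u) ≤ when (P? u) (f (h u))
      image u = ≤-trans (sum-support-≤ (pair u) (h u) (λ v hu≢v → when-no (h u ≟ v) hu≢v))
                        (when-≤ (h u ≟ h u) (λ _ → ≤-refl))

  module _ {P : Pred (Fin n) 0ℓ} (P? : Decidable P) where

    ∑-+ : ∀ f g → ∑⟨ P? ⟩ (λ v → f v + g v) ≡ ∑⟨ P? ⟩ f + ∑⟨ P? ⟩ g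
    ∑-+ f g =
      trans (sum-cong-≗ (λ v → split (P? v) {f v} {g v}))
            (∑-distrib-+ (λ v → when (P? v) (f v)) (λ v → when (P? v) (g v)))
      where
      split : ∀ {A : Set} (a? : Dec A) {l m} → when a? (l + m) ≡ when a? l + when a? m
      split (yes _) = refl
      split (no _)  = refl

    ∑-≤-count : ∀ {f} c → (∀ v → f v ≤ c) → ∑⟨ P? ⟩ f ≤ c * count P?
    ∑-≤-count zero    f≤c = ≤-trans (sum-const-≤ (λ v → when-≤ (P? v) (λ _ → f≤c v))) (≤-reflexive (*-zeroʳ n))
    ∑-≤-count {f} (suc c) f≤c = begin
      ∑⟨ P? ⟩ f                                ≤⟨ ∑-mono P? P? (λ p → p) (λ v _ → f≤c v) ⟩
      ∑⟨ P? ⟩ (λ _ → 1 + c)                    ≡⟨ ∑-+ (λ _ → 1) (λ _ → c) ⟩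
      count P? + ∑⟨ P? ⟩ (λ _ → c)             ≤⟨ +-monoʳ-≤ (count P?) (∑-≤-count c (λ _ → ≤-refl)) ⟩
      count P? + c * count P?                  ∎
      where open ≤-Reasoning

    count≤n : count P? ≤ n
    count≤n = ≤-trans (sum-const-≤ (λ v → when-≤ (P? v) (λ _ → ≤-refl))) (≤-reflexive (*-identityʳ n))

  module _ {P Q R : Pred (Fin n) 0ℓ} (P? : Decidable P) (Q? : Decidable Q) (R? : Decidable R) where

    ∑-cover : ∀ {f} → (∀ {v} → P v → Q v ⊎ R v) → ∑⟨ P? ⟩ f ≤ ∑⟨ Q? ⟩ f + ∑⟨ R? ⟩ f
    ∑-cover {f} P⊆Q∪R = ≤-trans (sum-mono-≤ (λ v → when-≤ (P? v) (λ p → bound v (P⊆Q∪R p))))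
                                (≤-reflexive (∑-distrib-+ (λ v → when (Q? v) (f v)) (λ v → when (R? v) (f v))))
      where
      bound : ∀ v → Q v ⊎ R v → f v ≤ when (Q? v) (f v) + when (R? v) (f v)
      bound v (inj₁ q) = m≤n⇒m≤n+o _ (≤-when (Q? v) q ≤-refl)
      bound v (inj₂ r) = m≤n⇒m≤o+n _ (≤-when (R? v) r ≤-refl)

    ∑-disjoint : ∀ {f} → (∀ {v} → Q v → P v) → (∀ {v} → R v → P v) → (∀ {v} → Q v → ¬ R v) →
                 ∑⟨ Q? ⟩ f + ∑⟨ R? ⟩ f ≤ ∑⟨ P? ⟩ f
    ∑-disjoint {f} Q⊆P R⊆P Q∩R=∅ =
      ≤-trans (≤-reflexive (sym (∑-distrib-+ (λ v → when (Q? v) (f v)) (λ v → when (R? v) (f v)))))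
              (sum-mono-≤ λ v → bound v (Q? v))
      where
      bound : ∀ v (q? : Dec (Q v)) → when q? (f v) + when (R? v) (f v) ≤ when (P? v) (f v)
      bound v (yes q) rewrite when-no (R? v) {f v} (Q∩R=∅ q) | +-identityʳ (f v) =
        ≤-when (P? v) (Q⊆P q) ≤-refl
      bound v (no _) = when-≤ (R? v) (λ r → ≤-when (P? v) (R⊆P r) ≤-refl)

-- Concavity of the integer logarithm.

-- The `1` pays for doubling the smaller number, and `2 * b` still fits under `a + b`.
⌊log₂⌋-+-half : ∀ a b → 0 < a → b ≤ a → 0 < b → ⌊log₂ a ⌋ + ⌊log₂ b ⌋ + 1 ≤ 2 * ⌊log₂ (a + b) ⌋
⌊log₂⌋-+-half a b 0<a b≤a 0<b = begin
  la + lb + 1                          ≡⟨ +-assoc la lb 1 ⟩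
  la + (lb + 1)                        ≡⟨ cong (la +_) (+-comm lb 1) ⟩
  la + (1 + lb)                        ≡⟨ cong (la +_) (sym (⌊log₂[2*b]⌋≡1+⌊log₂b⌋ b {{>-nonZero 0<b}})) ⟩
  la + ⌊log₂ (2 * b) ⌋                 ≤⟨ +-mono-≤ (⌊log₂⌋-mono-≤ (m≤m+n a b)) (⌊log₂⌋-mono-≤ 2b≤a+b) ⟩
  lab + lab                            ≡⟨ cong (lab +_) (sym (+-identityʳ lab)) ⟩
  2 * lab                              ∎
  where
  open ≤-Reasoning
  la = ⌊log₂ a ⌋
  lb = ⌊log₂ b ⌋
  lab = ⌊log₂ (a + b) ⌋
  2b≤a+b : 2 * b ≤ a + b
  2b≤a+b = +-mono-≤ b≤a (≤-reflexive (+-identityʳ b))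

-- An integer form of the concavity of the logarithm.
⌊log₂⌋-+ : ∀ {a b} → 0 < a → 0 < b → ⌊log₂ a ⌋ + ⌊log₂ b ⌋ + 1 ≤ 2 * ⌊log₂ (a + b) ⌋
⌊log₂⌋-+ {a} {b} 0<a 0<b with ≤-total b a
... | inj₁ b≤a = ⌊log₂⌋-+-half a b 0<a b≤a 0<b
... | inj₂ a≤b rewrite +-comm a b | +-comm ⌊log₂ a ⌋ ⌊log₂ b ⌋ = ⌊log₂⌋-+-half b a 0<b a≤b 0<a

-- One round of algorithm A

min-max : ∀ {n} (a b : Fin n) →
          (a F.≤ b × minF a b ≡ a × maxF a b ≡ b) ⊎ (b F.< a × minF a b ≡ b × maxF a b ≡ a)
min-max a b with toℕ a Data.Nat.≤ᵇ toℕ b | ≤ᵇ-reflects-≤ (toℕ a) (toℕ b)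
... | true  | ofʸ a≤b = inj₁ (a≤b , refl , refl)
... | false | ofⁿ a≰b = inj₂ (≰⇒> a≰b , refl , refl)

minF-≤ˡ : ∀ {n} (a b : Fin n) → minF a b F.≤ a
minF-≤ˡ a b with min-max a b
... | inj₁ (_   , min≡a , _) = ≤-reflexive (cong toℕ min≡a)
... | inj₂ (b<a , min≡b , _) = ≤-trans (≤-reflexive (cong toℕ min≡b)) (<⇒≤ b<a)

minF-≤ʳ : ∀ {n} (a b : Fin n) → minF a b F.≤ b
minF-≤ʳ a b with min-max a b
... | inj₁ (a≤b , min≡a , _) = ≤-trans (≤-reflexive (cong toℕ min≡a)) a≤b
... | inj₂ (_   , min≡b , _) = ≤-reflexive (cong toℕ min≡b)

maxF-> : ∀ {n} {a b : Fin n} → b F.< a → maxF a b ≡ a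
maxF-> {a = a} {b} b<a with min-max a b
... | inj₁ (a≤b , _ , _) = contradiction b<a (≤⇒≯ a≤b)
... | inj₂ (_ , _ , max≡a) = max≡a

maxF-≤ : ∀ {n} {a b : Fin n} → a F.≤ b → maxF a b ≡ b
maxF-≤ {a = a} {b} a≤b with min-max a b
... | inj₁ (_ , _ , max≡b) = max≡b
... | inj₂ (b<a , _ , _) = contradiction b<a (≤⇒≯ a≤b)

minF-sel : ∀ {n} (a b : Fin n) → minF a b ≡ a ⊎ minF a b ≡ b
minF-sel a b with min-max a b
... | inj₁ (_ , min≡a , _) = inj₁ min≡a
... | inj₂ (_ , min≡b , _) = inj₂ min≡b

Adj : ∀ {n} → List (Edge n) → Fin n → Fin n → Set
Adj es v w = (v , w) ∈ es ⊎ (w , v) ∈ es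

Adj-sym : ∀ {n} {es : List (Edge n)} {v w} → Adj es v w → Adj es w v
Adj-sym (inj₁ vw∈) = inj₂ vw∈
Adj-sym (inj₂ wv∈) = inj₁ wv∈

Adj-there : ∀ {n} {e} {es : List (Edge n)} {v w} → Adj es v w → Adj (e ∷ es) v w
Adj-there (inj₁ vw∈) = inj₁ (there vw∈)
Adj-there (inj₂ wv∈) = inj₂ (there wv∈)

adj? : ∀ {n} (es : List (Edge n)) v w → Dec (Adj es v w)
adj? es v w = ((v , w) ∈? es) ⊎-dec ((w , v) ∈? es)
  where open DecMembership (≡-dec _≟_ _≟_) using (_∈?_)

connect-≤-par : ∀ {n} p (es : List (Edge n)) v → connectUpdate (st p es) v F.≤ p v
connect-≤-par p []             v = ≤-refl
connect-≤-par p ((x , y) ∷ es) v with maxF x y ≟ v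
... | yes _ = ≤-trans (minF-≤ʳ (minF x y) _) (connect-≤-par p es v)
... | no  _ = connect-≤-par p es v

connect-≤-neighbour : ∀ {n} p (es : List (Edge n)) {v w} → Adj es v w → w F.< v →
                      connectUpdate (st p es) v F.≤ w
connect-≤-neighbour p ((x , y) ∷ es) {v} (inj₁ (here refl)) w<v with maxF x y ≟ v
... | yes _    = ≤-trans (minF-≤ˡ (minF x y) _) (minF-≤ʳ x y)
... | no max≢v = contradiction (maxF-> w<v) max≢v
connect-≤-neighbour p ((x , y) ∷ es) {v} (inj₂ (here refl)) w<v with maxF x y ≟ v
... | yes _    = ≤-trans (minF-≤ˡ (minF x y) _) (minF-≤ˡ x y)
... | no max≢v = contradiction (maxF-≤ (<⇒≤ w<v)) max≢v
connect-≤-neighbour p ((x , y) ∷ es) {v} (inj₁ (there vw∈)) w<v with maxF x y ≟ v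
... | yes _ = ≤-trans (minF-≤ʳ (minF x y) _) (connect-≤-neighbour p es (inj₁ vw∈) w<v)
... | no  _ = connect-≤-neighbour p es (inj₁ vw∈) w<v
connect-≤-neighbour p ((x , y) ∷ es) {v} (inj₂ (there wv∈)) w<v with maxF x y ≟ v
... | yes _ = ≤-trans (minF-≤ʳ (minF x y) _) (connect-≤-neighbour p es (inj₂ wv∈) w<v)
... | no  _ = connect-≤-neighbour p es (inj₂ wv∈) w<v

-- A fold of minima attains one of its candidates. This keeps parents occupied, and later shows that
-- an isolated root can neither move nor gain a child.
connect-sel : ∀ {n} p (es : List (Edge n)) v →
              connectUpdate (st p es) v ≡ p v ⊎ Adj es v (connectUpdate (st p es) v)
connect-sel p []             v = inj₁ refl
connect-sel p ((x , y) ∷ es) v with maxF x y ≟ v | connect-sel p es v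
... | no  _     | inj₁ ≡par = inj₁ ≡par
... | no  _     | inj₂ adj  = inj₂ (Adj-there adj)
... | yes max≡v | tail with minF-sel (minF x y) (connectUpdate (st p es) v)
...   | inj₂ ≡tail = subst (λ z → z ≡ p v ⊎ Adj ((x , y) ∷ es) v z) (sym ≡tail) (weaken tail)
  where
  weaken : ∀ {z} → z ≡ p v ⊎ Adj es v z → z ≡ p v ⊎ Adj ((x , y) ∷ es) v z
  weaken (inj₁ ≡par) = inj₁ ≡par
  weaken (inj₂ adj)  = inj₂ (Adj-there adj)
...   | inj₁ ≡min with min-max x y
...     | inj₁ (_ , min≡x , max≡y) = inj₂ (inj₂ (here (cong₂ _,_ (trans ≡min min≡x) (trans (sym max≡v) max≡y))))
...     | inj₂ (_ , min≡y , max≡x) = inj₂ (inj₁ (here (cong₂ _,_ (trans (sym max≡v) max≡x) (trans ≡min min≡y))))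

module _ {n : ℕ} (p : Fin n → Fin n) {es : List (Edge n)} where

  private
    alter-∈⁺ : ∀ {v w} → (v , w) ∈ es → p v ≢ p w → (p v , p w) ∈ alter p es
    alter-∈⁺ vw∈ pv≢pw = ∈-filter⁺ (λ e → ¬? (proj₁ e ≟ proj₂ e)) (∈-map⁺ (λ e → p (proj₁ e) , p (proj₂ e)) vw∈) pv≢pw

    alter-∈⁻ : ∀ {v w} → (v , w) ∈ alter p es →
               ∃₂ λ x y → (x , y) ∈ es × p x ≡ v × p y ≡ w × v ≢ w
    alter-∈⁻ vw∈ with ∈-filter⁻ (λ e → ¬? (proj₁ e ≟ proj₂ e)) vw∈
    ... | vw∈map , v≢w with ∈-map⁻ (λ e → p (proj₁ e) , p (proj₂ e)) vw∈map
    ... | (x , y) , xy∈ , refl = x , y , xy∈ , refl , refl , v≢w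

  alter-Adj⁺ : ∀ {v w} → Adj es v w → p v ≢ p w → Adj (alter p es) (p v) (p w)
  alter-Adj⁺ (inj₁ vw∈) pv≢pw = inj₁ (alter-∈⁺ vw∈ pv≢pw)
  alter-Adj⁺ (inj₂ wv∈) pv≢pw = inj₂ (alter-∈⁺ wv∈ (pv≢pw ∘ sym))

  alter-Adj⁻ : ∀ {v w} → Adj (alter p es) v w →
               ∃₂ λ x y → Adj es x y × p x ≡ v × p y ≡ w × v ≢ w
  alter-Adj⁻ (inj₁ vw∈) with alter-∈⁻ vw∈
  ... | x , y , xy∈ , px≡v , py≡w , v≢w = x , y , inj₁ xy∈ , px≡v , py≡w , v≢w
  alter-Adj⁻ (inj₂ wv∈) with alter-∈⁻ wv∈
  ... | y , x , yx∈ , py≡w , px≡v , w≢v = x , y , inj₂ yx∈ , px≡v , py≡w , w≢v ∘ sym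

-- Tokens, the forest of `q` and the sum `Φ`.

-- `token` is bookkeeping of the analysis: `token u` is the present place of the token that started
-- at `u`. The last three fields are invariants of a round.
record Configuration (n : ℕ) : Set where
  field
    state : State n
    token : Fin n → Fin n

  Occupied : Pred (Fin n) 0ℓ
  Occupied v = ∃ λ u → token u ≡ v

  field
    par-≤         : ∀ v → par state v F.≤ v
    par-occupied  : ∀ {v} → Occupied v → Occupied (par state v)
    ends-occupied : ∀ {v w} → Adj (edges state) v w → Occupied v

  q : Fin n → Fin n
  q = connectUpdate state

  _~_ : Fin n → Fin n → Set
  _~_ = Adj (edges state)

  q-≤-par : ∀ v → q v F.≤ par state v
  q-≤-par = connect-≤-par (par state) (edges state)

  q-≤ : ∀ v → q v F.≤ v
  q-≤ v = ≤-trans (q-≤-par v) (par-≤ v)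

  q-≤-neighbour : ∀ {v w} → v ~ w → w F.< v → q v F.≤ w
  q-≤-neighbour = connect-≤-neighbour (par state) (edges state)

  q-sel : ∀ v → q v ≡ par state v ⊎ v ~ q v
  q-sel = connect-sel (par state) (edges state)

  q-occupied : ∀ {v} → Occupied v → Occupied (q v)
  q-occupied {v} occ with q-sel v
  ... | inj₁ ≡par = subst Occupied (sym ≡par) (par-occupied occ)
  ... | inj₂ adj  = ends-occupied (Adj-sym adj)

  occupied? : Decidable Occupied
  occupied? v = any? λ u → token u ≟ v

  Nonroot : Pred (Fin n) 0ℓ
  Nonroot v = Occupied v × q v ≢ v

  nonroot? : Decidable Nonroot
  nonroot? v = occupied? v ×-dec ¬? (q v ≟ v)

  Parent : Pred (Fin n) 0ℓ
  Parent v = ∃ λ u → Occupied u × u ≢ v × q u ≡ v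

  parent? : Decidable Parent
  parent? v = any? λ u → occupied? u ×-dec ¬? (u ≟ v) ×-dec (q u ≟ v)

  -- The input may contain loops, which only the first `alter` deletes; hence `w ≢ v`.
  NonIsolated : Pred (Fin n) 0ℓ
  NonIsolated v = ∃ λ w → v ~ w × w ≢ v

  nonIsolated? : Decidable NonIsolated
  nonIsolated? v = any? λ w → adj? (edges state) v w ×-dec ¬? (w ≟ v)

  -- An occupied vertex is inactive when it is a root without occupied children and without edges
  -- other than loops; this condition is permanent as long as the vertex is occupied.
  Active : Pred (Fin n) 0ℓ
  Active v = Occupied v × (q v ≢ v ⊎ Parent v ⊎ NonIsolated v)

  active? : Decidable Active
  active? v = occupied? v ×-dec (¬? (q v ≟ v) ⊎-dec parent? v ⊎-dec nonIsolated? v)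

  gapLog : Fin n → ℕ
  gapLog v = ⌊log₂ (toℕ v ∸ toℕ (q v)) ⌋

  gapLog-≤ : ∀ v → gapLog v ≤ ⌊log₂ n ⌋
  gapLog-≤ v = ⌊log₂⌋-mono-≤ (≤-trans (m∸n≤m (toℕ v) (toℕ (q v))) (<⇒≤ (toℕ<n v)))

  Φ : ℕ
  Φ = ∑⟨ nonroot? ⟩ gapLog

  next : Configuration n
  next = record
    { state         = round state
    ; token         = q ∘ q ∘ token
    ; par-≤         = λ v → ≤-trans (q-≤ (q v)) (q-≤ v)
    ; par-occupied  = λ { (u , refl) → image (q-occupied (q-occupied (u , refl))) }
    ; ends-occupied = λ adj → ends (alter-Adj⁻ (q ∘ q) adj)
    }
    where
    image : ∀ {x} → Occupied x → ∃ λ u → q (q (token u)) ≡ q (q x)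
    image (u , refl) = u , refl
    ends : ∀ {v w} → (∃₂ λ x y → x ~ y × q (q x) ≡ v × q (q y) ≡ w × v ≢ w) →
           ∃ λ u → q (q (token u)) ≡ v
    ends (x , y , x~y , refl , _ , _) = image (ends-occupied x~y)

-- Growth of `Φ` in one round.

module _ {n : ℕ} (c : Configuration n) where

  open Configuration c
  private module Next = Configuration next

  -- A survivor has a token from a grandchild, and a deep vertex one from a great-grandchild;
  -- the parent of an inner vertex is not a root.
  Survivor Lost Inner Deep : Pred (Fin n) 0ℓ
  Survivor v = Next.Occupied v × q v ≢ v
  Lost v     = Nonroot v × ¬ Next.Occupied v
  Inner v    = Nonroot v × q (q v) ≢ q v
  Deep v     = (∃ λ u → q (q (q (token u))) ≡ v) × q v ≢ v

  survivor? : Decidable Survivor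
  survivor? v = Next.occupied? v ×-dec ¬? (q v ≟ v)

  lost? : Decidable Lost
  lost? v = nonroot? v ×-dec ¬? (Next.occupied? v)

  inner? : Decidable Inner
  inner? v = nonroot? v ×-dec ¬? (q (q v) ≟ q v)

  deep? : Decidable Deep
  deep? v = any? (λ u → q (q (q (token u))) ≟ v) ×-dec ¬? (q v ≟ v)

  innerSurvivor? : Decidable (λ v → Survivor v × q (q v) ≢ q v)
  innerSurvivor? v = survivor? v ×-dec ¬? (q (q v) ≟ q v)

  outerSurvivor? : Decidable (λ v → Survivor v × ¬ (q (q v) ≢ q v))
  outerSurvivor? v = survivor? v ×-dec ¬? (¬? (q (q v) ≟ q v))

  shallowSurvivor? : Decidable (λ v → Survivor v × ¬ Deep v)
  shallowSurvivor? v = survivor? v ×-dec ¬? (deep? v)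

  nextOccupied⇒occupied : ∀ {v} → Next.Occupied v → Occupied v
  nextOccupied⇒occupied (u , refl) = q-occupied (q-occupied (u , refl))

  -- The child through which a survivor receives a token is inner, since its parent, the survivor,
  -- is not a root.
  survivors-≤-inner : count survivor? ≤ count inner?
  survivors-≤-inner = ∑-surjection inner? survivor? q
    λ { _ ((u , refl) , nonroot) →
        q (token u) , ((q-occupied (u , refl) , nonroot ∘ cong q) , nonroot) , refl }

  -- The child `q (token u)` below a shallow survivor is lost: a token arriving at that child from a
  -- grandchild would make the survivor deep.
  shallow-≤-lost : count shallowSurvivor? ≤ count lost?
  shallow-≤-lost = ∑-surjection lost? shallowSurvivor? q
    λ { _ (((u , refl) , nonroot) , shallow) →
        q (token u)
      , ((q-occupied (u , refl) , nonroot ∘ cong q)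
        , λ { (u′ , eq) → shallow ((u′ , cong q eq) , nonroot) })
      , refl }

  -- The child through which the great-grandchild is reached is itself a survivor; were it a root,
  -- it would coincide with the deep vertex.
  deep-≤-survivors : ∀ {f} → ∑⟨ deep? ⟩ f ≤ ∑⟨ survivor? ⟩ (f ∘ q)
  deep-≤-survivors = ∑-surjection survivor? deep? q
    λ { _ ((u , refl) , nonroot) →
        q (q (token u)) , ((u , refl) , nonroot ∘ cong q) , refl }

  gapLog² : Fin n → ℕ
  gapLog² v = ⌊log₂ (toℕ v ∸ toℕ (q (q v))) ⌋

  gapLog²-≥ : ∀ v → gapLog v + gapLog (q v) ≤ gapLog² v + gapLog² v
  gapLog²-≥ v = +-mono-≤ (⌊log₂⌋-mono-≤ (∸-monoʳ-≤ (toℕ v) (q-≤ (q v))))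
                         (⌊log₂⌋-mono-≤ (∸-monoˡ-≤ (toℕ (q (q v))) (q-≤ v)))

  q-< : ∀ {v} → q v ≢ v → q v F.< v
  q-< {v} qv≢v = ≤∧≢⇒< (q-≤ v) (qv≢v ∘ toℕ-injective)

  gapLog²-gain : ∀ {v} → q v ≢ v → q (q v) ≢ q v →
                 gapLog v + gapLog (q v) + 1 ≤ gapLog² v + gapLog² v
  gapLog²-gain {v} qv≢v qqv≢qv = begin
    gapLog v + gapLog (q v) + 1
      ≤⟨ ⌊log₂⌋-+ (m<n⇒0<n∸m (q-< qv≢v)) (m<n⇒0<n∸m (q-< qqv≢qv)) ⟩
    2 * ⌊log₂ ((toℕ v ∸ toℕ (q v)) + (toℕ (q v) ∸ toℕ (q (q v)))) ⌋
      ≡⟨ cong (λ z → 2 * ⌊log₂ z ⌋) gaps ⟩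
    2 * gapLog² v
      ≡⟨ cong (gapLog² v +_) (+-identityʳ (gapLog² v)) ⟩
    gapLog² v + gapLog² v ∎
    where
    open ≤-Reasoning
    gaps : (toℕ v ∸ toℕ (q v)) + (toℕ (q v) ∸ toℕ (q (q v))) ≡ toℕ v ∸ toℕ (q (q v))
    gaps = trans (sym (+-∸-assoc (toℕ v ∸ toℕ (q v)) (q-≤ (q v))))
                 (cong (_∸ toℕ (q (q v))) (m∸n+n≡m (q-≤ v)))

  -- The gain of `1` needs both gaps positive, so only survivors with a nonroot parent contribute
  -- it; monotonicity suffices for the others.
  survivors-gain : ∑⟨ survivor? ⟩ gapLog + ∑⟨ survivor? ⟩ (gapLog ∘ q) + count innerSurvivor? ≤
                   ∑⟨ survivor? ⟩ gapLog² + ∑⟨ survivor? ⟩ gapLog²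
  survivors-gain = begin
    ∑⟨ survivor? ⟩ gapLog + ∑⟨ survivor? ⟩ (gapLog ∘ q) + count innerSurvivor?
      ≡⟨ cong (_+ count innerSurvivor?) (sym (∑-+ survivor? gapLog (gapLog ∘ q))) ⟩
    ∑⟨ survivor? ⟩ old + count innerSurvivor?
      ≤⟨ +-monoˡ-≤ (count innerSurvivor?) (∑-cover survivor? innerSurvivor? outerSurvivor? split) ⟩
    ∑⟨ innerSurvivor? ⟩ old + ∑⟨ outerSurvivor? ⟩ old + count innerSurvivor?
      ≡⟨ swap (∑⟨ innerSurvivor? ⟩ old) (∑⟨ outerSurvivor? ⟩ old) (count innerSurvivor?) ⟩
    ∑⟨ innerSurvivor? ⟩ old + count innerSurvivor? + ∑⟨ outerSurvivor? ⟩ old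
      ≡⟨ cong (_+ ∑⟨ outerSurvivor? ⟩ old) (sym (∑-+ innerSurvivor? old (λ _ → 1))) ⟩
    ∑⟨ innerSurvivor? ⟩ (λ v → old v + 1) + ∑⟨ outerSurvivor? ⟩ old
      ≤⟨ +-mono-≤ (∑-mono innerSurvivor? innerSurvivor? (λ s → s)
                    (λ { v ((_ , qv≢v) , qqv≢qv) → gapLog²-gain qv≢v qqv≢qv }))
                  (∑-mono outerSurvivor? outerSurvivor? (λ s → s) (λ v _ → gapLog²-≥ v)) ⟩
    ∑⟨ innerSurvivor? ⟩ new + ∑⟨ outerSurvivor? ⟩ new
      ≤⟨ ∑-disjoint survivor? innerSurvivor? outerSurvivor? proj₁ proj₁ (λ { (_ , i) (_ , o) → o i }) ⟩
    ∑⟨ survivor? ⟩ new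
      ≡⟨ ∑-+ survivor? gapLog² gapLog² ⟩
    ∑⟨ survivor? ⟩ gapLog² + ∑⟨ survivor? ⟩ gapLog² ∎
    where
    open ≤-Reasoning
    old new : Fin n → ℕ
    old v = gapLog v + gapLog (q v)
    new v = gapLog² v + gapLog² v
    swap : ∀ a b d → a + b + d ≡ a + d + b
    swap = solve-∀
    split : ∀ {v} → Survivor v →
            (Survivor v × q (q v) ≢ q v) ⊎ (Survivor v × ¬ (q (q v) ≢ q v))
    split {v} s with q (q v) ≟ q v
    ... | yes eq = inj₂ (s , λ neq → neq eq)
    ... | no neq = inj₁ (s , neq)

  survivor⇒nextNonroot : ∀ {v} → Survivor v → Next.Nonroot v
  survivor⇒nextNonroot {v} (occ , qv≢v) = occ , λ q′v≡v → qv≢v (toℕ-injective (≤-antisym (q-≤ v)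
    (subst (F._≤ q v) q′v≡v (≤-trans (Next.q-≤-par v) (q-≤ (q v))))))

  -- The next connect can only lower the parent `q (q v)`, which widens the gap.
  survivors-≤-nextΦ : ∑⟨ survivor? ⟩ gapLog² ≤ Next.Φ
  survivors-≤-nextΦ = ∑-mono survivor? Next.nonroot? survivor⇒nextNonroot
    λ v _ → ⌊log₂⌋-mono-≤ (∸-monoʳ-≤ (toℕ v) (Next.q-≤-par v))

  nonroot⇒survivor⊎lost : ∀ {v} → Nonroot v → Survivor v ⊎ Lost v
  nonroot⇒survivor⊎lost {v} nr@(_ , qv≢v) with Next.occupied? v
  ... | yes occ = inj₁ (occ , qv≢v)
  ... | no ¬occ = inj₂ (nr , ¬occ)

  private
    ℓ = ⌊log₂ n ⌋
    rate = 3 * ℓ + 2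

  Φ-≤-survivors : Φ ≤ ∑⟨ survivor? ⟩ gapLog + ℓ * count lost?
  Φ-≤-survivors = ≤-trans (∑-cover nonroot? survivor? lost? nonroot⇒survivor⊎lost)
    (+-monoʳ-≤ _ (∑-≤-count lost? ℓ gapLog-≤))

  -- A deep vertex is the parent of a survivor, so its term reappears on the right; each shallow one
  -- costs at most `ℓ` and is charged to a lost vertex.
  survivors-≤-shifted : ∑⟨ survivor? ⟩ gapLog ≤ ∑⟨ survivor? ⟩ (gapLog ∘ q) + ℓ * count lost?
  survivors-≤-shifted = ≤-trans (∑-cover survivor? deep? shallowSurvivor? split)
    (+-mono-≤ deep-≤-survivors
      (≤-trans (∑-≤-count shallowSurvivor? ℓ gapLog-≤) (*-monoʳ-≤ ℓ shallow-≤-lost)))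
    where
    split : ∀ {v} → Survivor v → Deep v ⊎ (Survivor v × ¬ Deep v)
    split {v} s with deep? v
    ... | yes d = inj₁ d
    ... | no ¬d = inj₂ (s , ¬d)

  -- Expresses the gain of `survivors-gain` through all nonroots. Lost vertices enter twice: as
  -- nonroots that do not survive, and as inner vertices that do not.
  nonroots-≤ : count nonroot? ≤ count innerSurvivor? + count lost? + count lost?
  nonroots-≤ = begin
    count nonroot?                                        ≤⟨ ∑-cover nonroot? survivor? lost? nonroot⇒survivor⊎lost ⟩
    count survivor? + count lost?                         ≤⟨ +-monoˡ-≤ _ survivors-≤-inner ⟩
    count inner? + count lost?                            ≤⟨ +-monoˡ-≤ _ (∑-cover inner? innerSurvivor? lost? split) ⟩
    count innerSurvivor? + count lost? + count lost?      ∎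
    where
    open ≤-Reasoning
    split : ∀ {v} → Inner v → (Survivor v × q (q v) ≢ q v) ⊎ Lost v
    split (nr , inner) with nonroot⇒survivor⊎lost nr
    ... | inj₁ s = inj₁ (s , inner)
    ... | inj₂ l = inj₂ l

  -- One copy of `Φ` stays on the survivors and the other is moved to their parents, matching the
  -- two old summands in `survivors-gain`.
  Φ-growth : 2 * Φ + count nonroot? ≤ 2 * Next.Φ + rate * count lost?
  Φ-growth = begin
    2 * Φ + count nonroot?
      ≤⟨ +-mono-≤ (+-mono-≤ Φ-≤-survivors (+-monoˡ-≤ 0
           (≤-trans Φ-≤-survivors (+-monoˡ-≤ _ survivors-≤-shifted)))) nonroots-≤ ⟩
    -- Two terms `ℓ * L` come from `Φ-≤-survivors`, one from `survivors-≤-shifted`, and `L + L` from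
    -- `nonroots-≤`: together `3 * ℓ + 2`.
    (S + ℓ * L) + ((S′ + ℓ * L + ℓ * L) + 0) + (I + L + L)
      ≡⟨ regroup S S′ I ℓ L ⟩
    (S + S′ + I) + rate * L
      ≤⟨ +-monoˡ-≤ (rate * L) (≤-trans survivors-gain
           (+-mono-≤ survivors-≤-nextΦ survivors-≤-nextΦ)) ⟩
    Next.Φ + Next.Φ + rate * L
      ≡⟨ cong (λ z → Next.Φ + z + rate * L) (sym (+-identityʳ Next.Φ)) ⟩
    2 * Next.Φ + rate * L ∎
    where
    open ≤-Reasoning
    S = ∑⟨ survivor? ⟩ gapLog
    S′ = ∑⟨ survivor? ⟩ (gapLog ∘ q)
    I = count innerSurvivor?
    L = count lost?
    regroup : ∀ s s′ i l k → (s + l * k) + ((s′ + l * k + l * k) + 0) + (i + k + k) ≡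
                             (s + s′ + i) + (3 * l + 2) * k
    regroup = solve-∀

  -- Evolution of the active vertices.

  module _ {v : Fin n} (root : q v ≡ v) (childless : ¬ Parent v) where

    only-preimage : ∀ {x} → Occupied x → q x ≡ v → x ≡ v
    only-preimage {x} occ qx≡v with x ≟ v
    ... | yes x≡v = x≡v
    ... | no x≢v  = contradiction (x , occ , x≢v , qx≡v) childless

    only-preimage² : ∀ {x} → Occupied x → q (q x) ≡ v → x ≡ v
    only-preimage² occ qqx≡v = only-preimage occ (only-preimage (q-occupied occ) qqx≡v)

    -- An end can arrive at `v` only from `v` itself, so a new edge at `v` comes from an old one; a
    -- loop there would have been deleted by `alter`.
    stays-isolated : ¬ NonIsolated v → ∀ {w} → ¬ (v Next.~ w)
    stays-isolated isolated v~w with alter-Adj⁻ (q ∘ q) v~w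
    ... | x , y , x~y , qqx≡v , qqy≡w , v≢w with only-preimage² (ends-occupied x~y) qqx≡v
    ... | refl with y ≟ v
    ...   | yes refl = v≢w (trans (sym qqx≡v) qqy≡w)
    ...   | no y≢v   = isolated (y , x~y , y≢v)

    -- By `q-sel`, a new parent or child of `v` is either inherited from `q ∘ q`, where `v` is fixed
    -- and its own only occupied preimage, or comes along an edge, and `v` has none left.
    stays-inactive : ¬ NonIsolated v → ¬ Next.Active v
    stays-inactive isolated (_ , inj₁ nonroot) with Next.q-sel v
    ... | inj₁ ≡par = nonroot (trans ≡par (trans (cong q root) root))
    ... | inj₂ adj  = stays-isolated isolated adj
    stays-inactive isolated (_ , inj₂ (inj₁ (u , occ , u≢v , q′u≡v))) with Next.q-sel u
    ... | inj₁ ≡par = u≢v (only-preimage² (nextOccupied⇒occupied occ) (trans (sym ≡par) q′u≡v))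
    ... | inj₂ adj  = stays-isolated isolated (Adj-sym (subst (u Next.~_) q′u≡v adj))
    stays-inactive isolated (_ , inj₂ (inj₂ (_ , adj , _))) = stays-isolated isolated adj

    -- Every neighbour of such a root gets a parent below it, and so the root
    -- has a smaller neighbour in the next round.
    becomes-nonroot : Occupied v → NonIsolated v → Next.Nonroot v
    becomes-nonroot (u , refl) (w , v~w , w≢v) = (u , qqv≡v) , λ q′v≡v →
      <⇒≢ (≤-<-trans (Next.q-≤-neighbour v~′qqw qqw<v) qqw<v) (cong toℕ q′v≡v)
      where
      qqv≡v : q (q v) ≡ v
      qqv≡v = trans (cong q root) root
      v<w : v F.< w
      v<w = ≤∧≢⇒< (≮⇒≥ λ w<v → ≤⇒≯ (q-≤-neighbour v~w w<v) (subst (w F.<_) (sym root) w<v))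
                  (w≢v ∘ sym ∘ toℕ-injective)
      qqw<v : q (q w) F.< v
      qqw<v = ≤-<-trans (q-≤ (q w)) (≤∧≢⇒< (q-≤-neighbour (Adj-sym v~w) v<w)
        (λ qw≡v → childless (w , ends-occupied (Adj-sym v~w) , w≢v , toℕ-injective qw≡v)))
      v~′qqw : v Next.~ q (q w)
      v~′qqw = subst (Next._~ q (q w)) qqv≡v
        (alter-Adj⁺ (q ∘ q) v~w (λ eq → <⇒≢ qqw<v (cong toℕ (trans (sym eq) qqv≡v))))

  nextActive⇒active : ∀ {v} → Next.Active v → Active v
  nextActive⇒active {v} act@(occ , _) with q v ≟ v | parent? v | nonIsolated? v
  ... | no nonroot | _            | _            = nextOccupied⇒occupied occ , inj₁ nonroot
  ... | yes _      | yes parent   | _            = nextOccupied⇒occupied occ , inj₂ (inj₁ parent)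
  ... | yes _      | no _         | yes adjacent = nextOccupied⇒occupied occ , inj₂ (inj₂ adjacent)
  ... | yes root   | no childless | no isolated  =
    contradiction act (stays-inactive root childless isolated)

  -- A lost vertex is active as a nonroot but no longer occupied afterwards. This drop pays for the
  -- error term of `Φ-growth`.
  active-decrease : count Next.active? + count lost? ≤ count active?
  active-decrease = ∑-disjoint active? Next.active? lost? nextActive⇒active
    (λ { ((occ , nonroot) , _) → occ , inj₁ nonroot }) (λ { (occ , _) (_ , ¬occ) → ¬occ occ })

  -- An active root with a child is charged to a nonroot child; a childless one becomes a nonroot in
  -- the next round. The latter case is why decay is measured over two rounds.
  active-≤-nonroots : count active? ≤ count nonroot? + (count nonroot? + count Next.nonroot?)
  active-≤-nonroots = ≤-trans (∑-cover active? nonroot? other? split)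
    (+-monoʳ-≤ (count nonroot?) (≤-trans (∑-cover other? parent? Next.nonroot? (λ o → o))
      (+-monoˡ-≤ (count Next.nonroot?) parents-≤)))
    where
    other? : Decidable (λ v → Parent v ⊎ Next.Nonroot v)
    other? v = parent? v ⊎-dec Next.nonroot? v
    split : ∀ {v} → Active v → Nonroot v ⊎ (Parent v ⊎ Next.Nonroot v)
    split {v} (occ , act) with q v ≟ v | parent? v | act
    ... | no nonroot | _            | _                    = inj₁ (occ , nonroot)
    ... | yes _      | yes parent   | _                    = inj₂ (inj₁ parent)
    ... | yes root   | no _         | inj₁ nonroot         = contradiction root nonroot
    ... | yes _      | no childless | inj₂ (inj₁ parent)   = contradiction parent childless
    ... | yes root   | no childless | inj₂ (inj₂ adjacent) =
      inj₂ (inj₂ (becomes-nonroot root childless occ adjacent))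
    parents-≤ : count parent? ≤ count nonroot?
    parents-≤ = ∑-surjection nonroot? parent? q
      λ { _ (u , occ , u≢qu , refl) → u , (occ , u≢qu ∘ sym) , refl }

  -- A surviving edge is not a loop, so its end would be active. The claim concerns the state after
  -- the round because input loops make no vertex active.
  no-active⇒no-edges : (∀ v → ¬ Active v) → edges (round state) ≡ []
  no-active⇒no-edges inactive = empty (edges (round state)) λ v w vw∈ →
    inactive v (nextActive⇒active (Next.ends-occupied (inj₁ vw∈) , inj₂ (inj₂ (w , inj₁ vw∈ , loopless vw∈))))
    where
    empty : ∀ (es : List (Edge n)) → (∀ v w → ¬ ((v , w) ∈ es)) → es ≡ []
    empty []             _  = refl
    empty ((v , w) ∷ es) ∉es = contradiction (here refl) (∉es v w)
    loopless : ∀ {v w} → (v , w) ∈ edges (round state) → w ≢ v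
    loopless vw∈ w≡v with alter-Adj⁻ (q ∘ q) {edges state} (inj₁ vw∈)
    ... | _ , _ , _ , _ , _ , v≢w = v≢w (sym w≡v)

-- Decay of the potential.

-- The coefficient of the lost vertices in `Φ-growth`, so that weighting the active vertices with it
-- cancels that error.
rate : ℕ → ℕ
rate n = 3 * ⌊log₂ n ⌋ + 2

-- The subtraction never truncates, since Φ ≤ ⌊log₂ n⌋ · |active|.
potential : ∀ {n} → Configuration n → ℕ
potential {n} c = rate n * count active? ∸ 2 * Φ
  where open Configuration c

module _ {n : ℕ} (c : Configuration n) where

  open Configuration c
  private
    ℓ = ⌊log₂ n ⌋
    r = rate n
    module Next = Configuration next

  2active+2Φ≤ : 2 * count active? + 2 * Φ ≤ r * count active?
  2active+2Φ≤ = begin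
    2 * V + 2 * Φ                ≤⟨ +-monoʳ-≤ (2 * V) (*-monoʳ-≤ 2 Φ≤) ⟩
    2 * V + 2 * (ℓ * V)          ≤⟨ m≤m+n _ (ℓ * V) ⟩
    2 * V + 2 * (ℓ * V) + ℓ * V  ≡⟨ regroup ℓ V ⟩
    r * V                        ∎
    where
    open ≤-Reasoning
    V = count active?
    Φ≤ : Φ ≤ ℓ * V
    Φ≤ = ≤-trans (∑-≤-count nonroot? ℓ gapLog-≤)
      (*-monoʳ-≤ ℓ (∑-mono nonroot? active? (λ { (occ , nonroot) → occ , inj₁ nonroot }) (λ _ _ → ≤-refl)))
    regroup : ∀ l v → 2 * v + 2 * (l * v) + l * v ≡ (3 * l + 2) * v
    regroup = solve-∀

  2active≤potential : 2 * count active? ≤ potential c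
  2active≤potential = m+n≤o⇒m≤o∸n (2 * count active?) 2active+2Φ≤

  potential+2Φ : potential c + 2 * Φ ≡ r * count active?
  potential+2Φ = m∸n+n≡m (m+n≤o⇒n≤o (2 * count active?) 2active+2Φ≤)

module _ {n : ℕ} (c : Configuration n) where

  open Configuration c
  private
    r = rate n
    module Next = Configuration next

  potential-step : potential next + count nonroot? ≤ potential c
  -- Adding `2 * Next.Φ + 2 * Φ` clears the truncated subtraction on both sides.
  potential-step = +-cancelʳ-≤ (2 * Next.Φ + 2 * Φ) _ _ (begin
    P′ + N + (2 * Next.Φ + 2 * Φ)               ≡⟨ regroup₁ P′ N (2 * Next.Φ) (2 * Φ) ⟩
    2 * Φ + N + (P′ + 2 * Next.Φ)               ≡⟨ cong (2 * Φ + N +_) (potential+2Φ next) ⟩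
    2 * Φ + N + r * V′                          ≤⟨ +-monoˡ-≤ (r * V′) (Φ-growth c) ⟩
    2 * Next.Φ + r * L + r * V′                 ≡⟨ regroup₂ (2 * Next.Φ) r L V′ ⟩
    2 * Next.Φ + r * (V′ + L)                   ≤⟨ +-monoʳ-≤ (2 * Next.Φ) (*-monoʳ-≤ r (active-decrease c)) ⟩
    2 * Next.Φ + r * count active?              ≡⟨ cong (2 * Next.Φ +_) (sym (potential+2Φ c)) ⟩
    2 * Next.Φ + (potential c + 2 * Φ)          ≡⟨ regroup₃ (2 * Next.Φ) (potential c) (2 * Φ) ⟩
    potential c + (2 * Next.Φ + 2 * Φ)          ∎)
    where
    open ≤-Reasoning
    P′ = potential next
    N = count nonroot?
    V′ = count Next.active?
    L = count (lost? c)
    regroup₁ : ∀ a b x y → a + b + (x + y) ≡ y + b + (a + x)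
    regroup₁ = solve-∀
    regroup₂ : ∀ x k a b → x + k * a + k * b ≡ x + k * (b + a)
    regroup₂ = solve-∀
    regroup₃ : ∀ x a y → x + (a + y) ≡ a + (x + y)
    regroup₃ = solve-∀

module _ {n : ℕ} (c : Configuration n) where

  open Configuration c
  private
    r = rate n
    module Next = Configuration next

  -- Two rounds lose at least `N + N′`, while the potential is at most `r * (2 * N + N′)`; so a
  -- fraction `1 / (2 * r)` of it is lost.
  potential-decay : 2 * r * potential Next.next + potential c ≤ 2 * r * potential c
  potential-decay = begin
    2 * r * P″ + potential c                         ≤⟨ +-monoʳ-≤ (2 * r * P″) (m∸n≤m (r * count active?) (2 * Φ)) ⟩
    2 * r * P″ + r * count active?                   ≤⟨ +-monoʳ-≤ (2 * r * P″) (*-monoʳ-≤ r (active-≤-nonroots c)) ⟩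
    2 * r * P″ + r * (N + (N + N′))                  ≤⟨ m≤m+n _ (r * N′) ⟩
    2 * r * P″ + r * (N + (N + N′)) + r * N′         ≡⟨ regroup r P″ N N′ ⟩
    2 * r * (P″ + N′ + N)                            ≤⟨ *-monoʳ-≤ (2 * r) (+-monoˡ-≤ N (potential-step next)) ⟩
    2 * r * (potential next + N)                     ≤⟨ *-monoʳ-≤ (2 * r) (potential-step c) ⟩
    2 * r * potential c                              ∎
    where
    open ≤-Reasoning
    P″ = potential Next.next
    N = count nonroot?
    N′ = count Next.nonroot?
    regroup : ∀ k p a b → 2 * k * p + k * (a + (a + b)) + k * b ≡ 2 * k * (p + b + a)
    regroup = solve-∀

  potential≡0⇒inactive : potential c ≡ 0 → ∀ v → ¬ Active v
  potential≡0⇒inactive P≡0 v act = 1+n≰n (begin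
    1                     ≡⟨ sym (when-yes (active? v) act) ⟩
    when (active? v) 1    ≤⟨ term≤sum (λ u → when (active? u) 1) v ⟩
    count active?         ≤⟨ m≤m+n _ _ ⟩
    2 * count active?     ≤⟨ 2active≤potential c ⟩
    potential c           ≡⟨ P≡0 ⟩
    0                     ∎)
    where open ≤-Reasoning

-- Decay by a factor 1 − 1/D per step halves a sequence every D steps.
module _ (W : ℕ → ℕ) (D : ℕ) .{{_ : NonZero D}} (decay : ∀ i → D * W (suc i) + W i ≤ D * W i) where

  decay-mono : ∀ i → W (suc i) ≤ W i
  decay-mono i = *-cancelˡ-≤ D (≤-trans (m≤m+n _ _) (decay i))

  -- The `k` decrements telescope, and by monotonicity each is at least the last value `W (k + i)`.
  -- Taking `k = D` gives the halving.
  decay-sum : ∀ k i → D * W (k + i) + k * W (k + i) ≤ D * W i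
  decay-sum zero    i = ≤-reflexive (+-identityʳ _)
  decay-sum (suc k) i = begin
    D * W (suc (k + i)) + suc k * W (suc (k + i))      ≤⟨ +-monoʳ-≤ (D * W (suc (k + i))) (*-monoʳ-≤ (suc k) (decay-mono (k + i))) ⟩
    D * W (suc (k + i)) + (W (k + i) + k * W (k + i))  ≡⟨ sym (+-assoc (D * W (suc (k + i))) _ _) ⟩
    D * W (suc (k + i)) + W (k + i) + k * W (k + i)    ≤⟨ +-monoˡ-≤ _ (decay (k + i)) ⟩
    D * W (k + i) + k * W (k + i)                      ≤⟨ decay-sum k i ⟩
    D * W i                                            ∎
    where open ≤-Reasoning

  decay-halves : ∀ i → 2 * W (D + i) ≤ W i
  decay-halves i = *-cancelˡ-≤ D (≤-trans (≤-reflexive (regroup D (W (D + i)))) (decay-sum D i))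
    where
    regroup : ∀ d w → d * (2 * w) ≡ d * w + d * w
    regroup = solve-∀

  decay-geometric : ∀ j → 2 ^ j * W (j * D) ≤ W 0
  decay-geometric zero    = ≤-reflexive (+-identityʳ (W 0))
  decay-geometric (suc j) = begin
    2 * 2 ^ j * W (D + j * D)    ≡⟨ regroup (2 ^ j) (W (D + j * D)) ⟩
    2 ^ j * (2 * W (D + j * D))  ≤⟨ *-monoʳ-≤ (2 ^ j) (decay-halves (j * D)) ⟩
    2 ^ j * W (j * D)            ≤⟨ decay-geometric j ⟩
    W 0                          ∎
    where
    open ≤-Reasoning
    regroup : ∀ a w → 2 * a * w ≡ a * (2 * w)
    regroup = solve-∀

  decay-vanishes : ∀ j → W 0 < 2 ^ j → W (j * D) ≡ 0
  decay-vanishes j W0< with W (j * D) | decay-geometric j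
  ... | zero  | _     = refl
  ... | suc w | bound = contradiction (≤-trans (m≤m*n (2 ^ j) (suc w)) bound) (<⇒≱ W0<)

-- Number of rounds until no edge is left.

n<2^[1+⌊log₂n⌋] : ∀ n → n < 2 ^ suc ⌊log₂ n ⌋
n<2^[1+⌊log₂n⌋] n = ≰⇒> λ 2^≤n →
  1+n≰n (≤-trans (≤-reflexive (sym (⌊log₂[2^n]⌋≡n (suc ⌊log₂ n ⌋)))) (⌊log₂⌋-mono-≤ 2^≤n))

3k+2<2^[2+k] : ∀ k → 3 * k + 2 < 2 ^ (2 + k)
3k+2<2^[2+k] zero    = s≤s (s≤s (s≤s z≤n))
3k+2<2^[2+k] (suc k) = begin-strict
  3 * suc k + 2                  ≡⟨ regroup k ⟩
  3 + (3 * k + 2)                <⟨ +-mono-≤-< 3≤ (3k+2<2^[2+k] k) ⟩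
  2 ^ (2 + k) + 2 ^ (2 + k)      ≡⟨ cong (2 ^ (2 + k) +_) (sym (+-identityʳ (2 ^ (2 + k)))) ⟩
  2 ^ (3 + k)                    ∎
  where
  open ≤-Reasoning
  regroup : ∀ k → 3 * suc k + 2 ≡ 3 + (3 * k + 2)
  regroup = solve-∀
  3≤ : 3 ≤ 2 ^ (2 + k)
  3≤ = ≤-trans (n≤1+n 3) (^-monoʳ-≤ 2 (m≤m+n 2 k))

initial : ∀ {n} → List (Edge n) → Configuration n
initial es = record
  { state         = initState es
  ; token         = λ v → v
  ; par-≤         = λ _ → ≤-refl
  ; par-occupied  = λ {v} _ → v , refl
  ; ends-occupied = λ {v} _ → v , refl
  }

run : ∀ {n} → Configuration n → ℕ → Configuration n
run c = fold c Configuration.next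

-- `fold` adds rounds at the end, where the invariants are extended; `haltsWithin` consumes them
-- from the front, as `iterate` does.
run-state : ∀ {n} (c : Configuration n) k →
            Configuration.state (run c k) ≡ iterate round (Configuration.state c) k
run-state c k = trans (run-fold k) (iterate-is-fold (Configuration.state c) round k)
  where
  run-fold : ∀ k → Configuration.state (run c k) ≡ fold (Configuration.state c) round k
  run-fold zero    = refl
  run-fold (suc k) = cong round (run-fold k)

-- 3 + 2l halvings of the potential, each taking 2 · rate steps of two rounds.
edgelessAfter : ℕ → ℕ
edgelessAfter l = (3 + 2 * l) * (2 * (3 * l + 2)) * 2

potential-vanishes : ∀ {n} (c : Configuration n) → potential (run c (edgelessAfter ⌊log₂ n ⌋)) ≡ 0
potential-vanishes {n} c = decay-vanishes (λ i → potential (run c (i * 2))) (2 * rate n)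
  {{>-nonZero (*-mono-≤ {1} {2} (s≤s z≤n) 0<rate)}}
  -- `run c (suc i * 2)` computes to two applications of `next`.
  (λ i → potential-decay (run c (i * 2))) (3 + 2 * ⌊log₂ n ⌋) (begin-strict
  potential c                                    ≤⟨ m∸n≤m _ (2 * Φ) ⟩
  rate n * count active?                         ≤⟨ *-monoʳ-≤ (rate n) (count≤n active?) ⟩
  -- The exponents `2 + ⌊log₂ n ⌋` and `1 + ⌊log₂ n ⌋` add up to the number of halvings in
  -- `edgelessAfter`.
  rate n * n                                     <⟨ *-mono-< (3k+2<2^[2+k] ⌊log₂ n ⌋) (n<2^[1+⌊log₂n⌋] n) ⟩
  2 ^ (2 + ⌊log₂ n ⌋) * 2 ^ (1 + ⌊log₂ n ⌋)      ≡⟨ sym (^-distribˡ-+-* 2 (2 + ⌊log₂ n ⌋) (1 + ⌊log₂ n ⌋)) ⟩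
  2 ^ (2 + ⌊log₂ n ⌋ + (1 + ⌊log₂ n ⌋))          ≡⟨ cong (2 ^_) (regroup ⌊log₂ n ⌋) ⟩
  2 ^ (3 + 2 * ⌊log₂ n ⌋)                        ∎)
  where
  open ≤-Reasoning
  open Configuration c using (active?; Φ)
  0<rate : 0 < rate n
  0<rate = ≤-trans (s≤s z≤n) (m≤n+m 2 (3 * ⌊log₂ n ⌋))
  regroup : ∀ l → 2 + l + (1 + l) ≡ 3 + 2 * l
  regroup = solve-∀

-- Termination

sameFun-true : ∀ {n} {f g : Fin n → Fin n} → (∀ v → f v ≡ g v) → sameFun f g ≡ true
sameFun-true {n} {f} {g} f≗g = all (allFin n)
  where
  all : ∀ vs → foldr (λ v b → ⌊ f v ≟ g v ⌋ ∧ b) true vs ≡ true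
  all []       = refl
  all (v ∷ vs) with f v ≟ g v
  ... | yes _  = all vs
  ... | no f≢g = contradiction (f≗g v) f≢g

module _ {n : ℕ} where

  -- For a decreasing `p` this says that its trees have depth at most `h`.
  Settled : (Fin n → Fin n) → ℕ → Set
  Settled p h = ∀ v → p (fold v p h) ≡ fold v p h

  descent : ∀ {p : Fin n → Fin n} → (∀ v → p v F.≤ v) → ∀ v h →
            p (fold v p h) ≡ fold v p h ⊎ h + toℕ (fold v p h) ≤ toℕ v
  descent p≤ v zero    = inj₂ ≤-refl
  descent {p} p≤ v (suc h) with descent p≤ v h
  ... | inj₁ fixed = inj₁ (cong p fixed)
  ... | inj₂ low with p (fold v p h) ≟ fold v p h
  ...   | yes fixed = inj₁ (cong p fixed)
  ...   | no moves  = inj₂ (begin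
    suc h + toℕ (p (fold v p h))   ≡⟨ sym (+-suc h _) ⟩
    h + suc (toℕ (p (fold v p h))) ≤⟨ +-monoʳ-≤ h (≤∧≢⇒< (p≤ (fold v p h)) (moves ∘ toℕ-injective)) ⟩
    h + toℕ (fold v p h)           ≤⟨ low ⟩
    toℕ v                          ∎)
    where open ≤-Reasoning

  decreasing⇒settled : ∀ {p : Fin n → Fin n} → (∀ v → p v F.≤ v) → ∀ {h} → n < h → Settled p h
  decreasing⇒settled p≤ {h} n<h v with descent p≤ v h
  ... | inj₁ fixed = fixed
  ... | inj₂ low   = contradiction (≤-trans (m≤m+n h _) low) (<⇒≱ (<-trans (toℕ<n v) n<h))

  fold-shortcut : ∀ p v h → fold v (shortcut {n} p) h ≡ fold v p (h * 2)
  fold-shortcut p v zero    = refl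
  fold-shortcut p v (suc h) = cong (shortcut {n} p) (fold-shortcut p v h)

  shortcut-settled : ∀ p h → Settled p (h * 2) → Settled (shortcut {n} p) h
  shortcut-settled p h settled v = subst (λ x → shortcut {n} p x ≡ x) (sym (fold-shortcut p v h))
    (trans (cong p (settled v)) (settled v))

  -- Without edges a round is a bare shortcut, which halves the depth bound.
  settled⇒halts : ∀ k m p → Settled p (2 ^ k) → haltsWithin (suc k + m) (st p []) ≡ true
  -- At depth at most one the shortcut changes nothing; the one round counted here detects this.
  settled⇒halts zero m p settled
    rewrite sameFun-true {f = p} {p} (λ _ → refl) | sameFun-true {f = p} {shortcut p} (sym ∘ settled) = refl
  settled⇒halts (suc k) m p settled with noChange (st p [])
  ... | true  = refl
  ... | false = settled⇒halts k m (shortcut p)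
    (shortcut-settled p (2 ^ k) (subst (Settled p) (*-comm 2 (2 ^ k)) settled))

  haltsWithin-+ : ∀ k m (s : State n) → haltsWithin m (iterate round s k) ≡ true → haltsWithin (k + m) s ≡ true
  haltsWithin-+ zero    m s halts = halts
  haltsWithin-+ (suc k) m s halts with noChange s
  ... | true  = refl
  ... | false = haltsWithin-+ k m (round s) halts

-- One `suc` makes `2 ^ suc ⌊log₂ n ⌋` exceed `n` and hence every depth; the other counts the final
-- idle round.
decreasing⇒halts : ∀ {n} (p : Fin n → Fin n) → (∀ v → p v F.≤ v) → ∀ m →
                   haltsWithin (suc (suc ⌊log₂ n ⌋) + m) (st p []) ≡ true
decreasing⇒halts {n} p p≤ m =
  settled⇒halts (suc ⌊log₂ n ⌋) m p (decreasing⇒settled p≤ (n<2^[1+⌊log₂n⌋] n))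

halts-after : ∀ {n} (c : Configuration n) T K → potential (run c T) ≡ 0 →
  (∀ (p : Fin n → Fin n) → (∀ v → p v F.≤ v) → haltsWithin K (st p []) ≡ true) →
  haltsWithin (suc T + K) (Configuration.state c) ≡ true
-- The round after `T` is the one whose `alter` leaves no edge.
halts-after c T K P≡0 edgeless-halts = haltsWithin-+ (suc T) K (Configuration.state c)
  (subst (λ s → haltsWithin K s ≡ true) (run-state c (suc T))
    (subst (λ es → haltsWithin K (st (par state) es) ≡ true)
      (sym (no-active⇒no-edges (run c T) (potential≡0⇒inactive (run c T) P≡0)))
      (edgeless-halts (par state) par-≤)))
  where open Configuration (Configuration.next (run c T)) using (state; par-≤)

-- The total is `24 * l ^ 2 + 53 * l + 27` plus slack `m`, and `104 = 24 + 53 + 27` suffices once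
-- `l` is at least `1`, which is what `1 < n` provides.
rounds-≤ : ∀ l → 0 < l → ∃ λ m → 104 * l ^ 2 ≡ suc (edgelessAfter l) + (suc (suc l) + m)
rounds-≤ (suc l) _ = 80 * (l * l) + 107 * l ,
  trans (cong (λ z → 104 * (suc l * z)) (*-identityʳ (suc l))) (expand l)
  where
  expand : ∀ l → 104 * ((1 + l) * (1 + l)) ≡
    (1 + (3 + 2 * (1 + l)) * (2 * (3 * (1 + l) + 2)) * 2) + ((2 + (1 + l)) + (80 * (l * l) + 107 * l))
  expand = solve-∀

theorem13 : Σ ℕ λ c → (n : ℕ) → 1 < n → (es : List (Edge n)) →
    haltsWithin (c * ⌊log₂ n ⌋ ^ 2) (initState es) ≡ true
theorem13 = 104 , λ n 1<n es →
  let m , budget = rounds-≤ ⌊log₂ n ⌋ (⌊log₂⌋-mono-≤ 1<n)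
  in subst (λ k → haltsWithin k (initState es) ≡ true) (sym budget)
       (halts-after (initial es) (edgelessAfter ⌊log₂ n ⌋) (suc (suc ⌊log₂ n ⌋) + m)
         (potential-vanishes (initial es)) (λ p p≤ → decreasing⇒halts p p≤ m))
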